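{- Satisfiability of terms of $\mathrm{GRA}(e,p,s,I,\neg,\exists)$ can be checked by a finite automaton, i.e., the set of satisfiable terms of $\mathrm{GRA}(e,p,s,I,\neg,\exists)$ is in $\textsc{REG}$ (the class of regular languages).
   Context: AD-relations. $A^0=\{\epsilon\}$, with $\epsilon$ the empty tuple. A $k$-ary AD-relation over a set $A$ is a pair $(R,k)$ with $R\subseteq A^k$, $k\ge 0$; $t\in(R,k)$ means $t\in R$. Vocabularies contain only relation symbols (of any arity $k\ge 0$, countably infinitely many available for each arity). Models have nonempty domains; $A$ is the domain of $\mathfrak{A}$. Terms. $\mathrm{GRA}(e,p,s,I,\neg,\exists)$ is the set of terms built from relation symbols and the constant $e$ by the unary operators $p,s,I,\neg,\exists$; so each term has the form $f_1\cdots f_n(X)$ with $n\ge 0$, $f_i\in\{p,s,I,\neg,\exists\}$ and $X$ either $e$ or a relation symbol. Each term $\mathcal{T}$ defines in each model $\mathfrak{A}$ (of a vocabulary containing the relation symbols of $\mathcal{T}$) an AD-relation $\mathcal{T}^{\mathfrak{A}}$ over $A$ of arity $\mathit{ar}(\mathcal{T})$. Let $k=\mathit{ar}(\mathcal{T})$. - $R^{\mathfrak{A}}$ is the interpretation of $R$ in $\mathfrak{A}$, paired with the arity of $R$; $e^{\mathfrak{A}}=(\{(a,a)\mid a\in A\},2)$. - If $k\ge2$: $(p\mathcal{T})^{\mathfrak{A}}=(\{(a_k,a_1,\dots,a_{k-1})\mid(a_1,\dots,a_k)\in\mathcal{T}^{\mathfrak{A}}\},k)$; $(s\mathcal{T})^{\mathfrak{A}}=(\{(a_1,\dots,a_{k-2},a_k,a_{k-1})\mid(a_1,\dots,a_k)\in\mathcal{T}^{\mathfrak{A}}\},k)$;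 $(I\mathcal{T})^{\mathfrak{A}}=(\{(a_1,\dots,a_{k-1})\mid(a_1,\dots,a_k)\in\mathcal{T}^{\mathfrak{A}},\ a_{k-1}=a_k\},k-1)$. If $k\le1$, each of $p\mathcal{T},s\mathcal{T},I\mathcal{T}$ is interpreted as $\mathcal{T}^{\mathfrak{A}}$. - $(\neg\mathcal{T})^{\mathfrak{A}}=(\{t\in A^k\mid t\notin\mathcal{T}^{\mathfrak{A}}\},k)$. - If $k\ge1$: $(\exists\mathcal{T})^{\mathfrak{A}}=(\{(a_1,\dots,a_{k-1})\mid(a_1,\dots,a_k)\in\mathcal{T}^{\mathfrak{A}}\text{ for some }a_k\in A\},k-1)$; if $k=0$: $(\exists\mathcal{T})^{\mathfrak{A}}=\mathcal{T}^{\mathfrak{A}}$. A term $\mathcal{T}$ is satisfiable if there exists a model $\mathfrak{A}$ such that $\mathcal{T}^{\mathfrak{A}}$ is not the empty AD-relation $(\varnothing,\mathit{ar}(\mathcal{T}))$. -}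

module Defs where

open import Data.Bool using (Bool; T)
open import Data.Fin using (Fin)
open import Data.List using (List; []; _∷_; _++_; foldl; replicate)
open import Data.Nat using (ℕ; zero; suc)
open import Data.Product using (Σ-syntax; ∃-syntax; _×_; _,_)
open import Data.Unit using (⊤)
open import Data.Vec using (Vec; []; _∷_; _∷ʳ_; last)
open import Function.Bundles using (_↔_)
open import Level using (Level; 0ℓ) renaming (suc to lsuc; _⊔_ to _⊔ℓ_)
open import Relation.Binary.PropositionalEquality using (_≡_)
open import Relation.Nullary using (¬_)
open import Relation.Unary using (Pred; ∅; _∈_; _∉_; _≐_)

-- An AD-relation carries its arity in its type, so that for each arity there
-- is an empty relation of that arity.

ADRel : Set → ℕ → Set₁
ADRel A k = Pred (Vec A k) 0ℓ

arI : ℕ → ℕ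
arI (suc (suc k)) = suc k
arI k             = k

ar∃ : ℕ → ℕ
ar∃ (suc k) = k
ar∃ zero    = zero

-- In the operators below, v ∷ʳ a is the tuple v extended by a in last position.

module _ {A : Set} where

  eqRel : ADRel A 2
  eqRel t = ∃[ a ] t ≡ a ∷ a ∷ []

  pRel : ∀ {k} → ADRel A k → ADRel A k
  pRel {suc (suc k)} R t = Σ[ v ∈ Vec A (suc k) ] ∃[ a ] (v ∷ʳ a ∈ R × t ≡ a ∷ v)
  pRel {suc zero}    R   = R
  pRel {zero}        R   = R

  sRel : ∀ {k} → ADRel A k → ADRel A k
  sRel {suc (suc k)} R t =
    Σ[ v ∈ Vec A k ] ∃[ a ] ∃[ b ] ((v ∷ʳ a) ∷ʳ b ∈ R × t ≡ (v ∷ʳ b) ∷ʳ a)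
  sRel {suc zero}    R   = R
  sRel {zero}        R   = R

  IRel : ∀ {k} → ADRel A k → ADRel A (arI k)
  IRel {suc (suc k)} R t = ∃[ a ] (t ∷ʳ a ∈ R × last t ≡ a)
  IRel {suc zero}    R   = R
  IRel {zero}        R   = R

  ¬Rel : ∀ {k} → ADRel A k → ADRel A k
  ¬Rel R t = t ∉ R

  ∃Rel : ∀ {k} → ADRel A k → ADRel A (ar∃ k)
  ∃Rel {suc k} R t = ∃[ a ] t ∷ʳ a ∈ R
  ∃Rel {zero}  R   = R

-- Countably many symbols of each arity, numbered by index.

record RelSym : Set where
  constructor relSym
  field
    arity : ℕ
    index : ℕ

open RelSym public

Vocabulary : Set₁
Vocabulary = Pred RelSym 0ℓ

-- The membership proof is irrelevant, so that each symbol of τ has exactly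
-- one interpretation.

record Model (τ : Vocabulary) : Set₁ where
  field
    Domain   : Set
    nonempty : Domain
    interp   : (R : RelSym) → .(R ∈ τ) → ADRel Domain (arity R)

open Model public

data Term : Set where
  e   : Term
  rel : RelSym → Term
  p′ s′ I′ ¬′ ∃′ : Term → Term

ar : Term → ℕ
ar e       = 2
ar (rel R) = arity R
ar (p′ 𝒯)  = ar 𝒯
ar (s′ 𝒯)  = ar 𝒯
ar (I′ 𝒯)  = arI (ar 𝒯)
ar (¬′ 𝒯)  = ar 𝒯
ar (∃′ 𝒯)  = ar∃ (ar 𝒯)

SymbolsIn : Vocabulary → Term → Set
SymbolsIn τ e       = ⊤
SymbolsIn τ (rel R) = R ∈ τ
SymbolsIn τ (p′ 𝒯)  = SymbolsIn τ 𝒯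
SymbolsIn τ (s′ 𝒯)  = SymbolsIn τ 𝒯
SymbolsIn τ (I′ 𝒯)  = SymbolsIn τ 𝒯
SymbolsIn τ (¬′ 𝒯)  = SymbolsIn τ 𝒯
SymbolsIn τ (∃′ 𝒯)  = SymbolsIn τ 𝒯

⟦_⟧ : (𝒯 : Term) {τ : Vocabulary} (𝔄 : Model τ) → .(SymbolsIn τ 𝒯) → ADRel (Domain 𝔄) (ar 𝒯)
⟦ e     ⟧ 𝔄 _ = eqRel
⟦ rel R ⟧ 𝔄 m = interp 𝔄 R m
⟦ p′ 𝒯  ⟧ 𝔄 m = pRel (⟦ 𝒯 ⟧ 𝔄 m)
⟦ s′ 𝒯  ⟧ 𝔄 m = sRel (⟦ 𝒯 ⟧ 𝔄 m)
⟦ I′ 𝒯  ⟧ 𝔄 m = IRel (⟦ 𝒯 ⟧ 𝔄 m)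
⟦ ¬′ 𝒯  ⟧ 𝔄 m = ¬Rel (⟦ 𝒯 ⟧ 𝔄 m)
⟦ ∃′ 𝒯  ⟧ 𝔄 m = ∃Rel (⟦ 𝒯 ⟧ 𝔄 m)

SatisfiableTerm : Term → Set₁
SatisfiableTerm 𝒯 =
  Σ[ τ ∈ Vocabulary ] Σ[ m ∈ SymbolsIn τ 𝒯 ] Σ[ 𝔄 ∈ Model τ ] ¬ (⟦ 𝒯 ⟧ 𝔄 m ≐ ∅)

-- The infinitely many relation symbols are spelled over a finite alphabet: the
-- symbol of arity k and index i is the letter `R followed by k superscript
-- ticks and i subscript ticks.

data Letter : Set where
  `e `p `s `I `¬ `∃ `R `sup `sub : Letter

spellSym : RelSym → List Letter
spellSym R = `R ∷ replicate (arity R) `sup ++ replicate (index R) `sub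

spell : Term → List Letter
spell e       = `e ∷ []
spell (rel R) = spellSym R
spell (p′ 𝒯)  = `p ∷ spell 𝒯
spell (s′ 𝒯)  = `s ∷ spell 𝒯
spell (I′ 𝒯)  = `I ∷ spell 𝒯
spell (¬′ 𝒯)  = `¬ ∷ spell 𝒯
spell (∃′ 𝒯)  = `∃ ∷ spell 𝒯

Language : Set → (ℓ : Level) → Set (lsuc ℓ)
Language X ℓ = Pred (List X) ℓ

SatisfiableTerms : Language Letter (lsuc 0ℓ)
SatisfiableTerms w = ∃[ 𝒯 ] (spell 𝒯 ≡ w × SatisfiableTerm 𝒯)

Finite : Set → Set
Finite X = ∃[ n ] (X ↔ Fin n)

record DFA (X : Set) : Set₁ where
  field
    finiteAlphabet : Finite X
    State          : Set
    finiteState    : Finite State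
    start          : State
    step           : State → X → State
    final          : State → Bool

accepted : {X : Set} → DFA X → Language X 0ℓ
accepted M w = T (final (foldl step start w))
  where open DFA M

REG : ∀ {X ℓ} → Language X ℓ → Set (lsuc 0ℓ ⊔ℓ ℓ)
REG {X} L = Σ[ M ∈ DFA X ] L ≐ accepted M

{-# OPTIONS --safe #-}
-- If X is a relation symbol then f₁⋯fₙ(X) is satisfiable: p, s, I and ∃ keep
-- full relations full and empty relations empty, and ¬ swaps the two, so a
-- suitable interpretation of X by a full or an empty relation makes the term
-- full. If X is e then, before the first I or ∃ is applied, the term denotes =
-- or ≠, and afterwards a full or an empty relation. Which one does not depend
-- on the model, except that ∃ turns ≠ into a relation that is empty over one
-- element and full over two or more; after that step a term stays satisfiable
-- under all further operators. Hence only finitely many values matter, and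
-- since words are read from the outermost operator inwards, the automaton
-- remembers which values of the unread subterm make the whole term satisfiable.
module Submission where

open import Data.Bool using (Bool; true; false; not; _xor_; T; if_then_else_)
open import Data.Bool.Properties using (not-distribˡ-xor; not-involutive)
open import Data.Fin using (Fin; _≟_)
open import Data.Fin.Patterns
open import Data.Fin.Properties using (2↔Bool; *↔×; +↔⊎; all?)
open import Data.List using (List; []; _∷_; _++_; foldl; replicate)
open import Data.Nat using (ℕ; zero; suc; _+_; _*_)
open import Data.Product using (Σ-syntax; ∃; ∃-syntax; _×_; _,_)
open import Data.Product.Function.NonDependent.Propositional using (_×-↔_)
open import Data.Sum using (_⊎_; inj₁; inj₂)
open import Data.Sum.Function.Propositional using (_⊎-↔_)
open import Data.Unit using (⊤; tt)
open import Data.Vec as Vec using (Vec; []; _∷_; _∷ʳ_; last; lookup; initLast)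
open import Function using (id; _∘_)
open import Function.Bundles using (mk↔ₛ′)
open import Function.Properties.Inverse using (↔-sym; ↔-trans)
open import Relation.Binary.PropositionalEquality
  using (_≡_; _≢_; refl; sym; trans; cong; subst; ≢-sym)
open import Relation.Nullary using (¬_; contradiction)
open import Relation.Nullary.Decidable using (True; toWitness)
open import Relation.Nullary.Reflects using (Reflects; ofʸ; ofⁿ; invert; ¬-reflects)
open import Relation.Unary using (_∈_; _⊆_; U)

open import Defs

-- Abstract values of terms

-- equality b stands for = or ≠, uniform b for a full or an empty relation, and
-- varying b for a relation that is uniform with truth value b xor l in the
-- models that are extremal for l (see below).

data Value : Set where
  equality uniform varying : Bool → Value

¬ᵛ : Value → Value
¬ᵛ (equality b) = equality (not b)
¬ᵛ (uniform b)  = uniform (not b)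
¬ᵛ (varying b)  = varying (not b)

Iᵛ : Value → Value
Iᵛ (equality b) = uniform b
Iᵛ v            = v

∃ᵛ : Value → Value
∃ᵛ (equality true)  = uniform true
-- Some element differs from a given one exactly over several elements, that is for `l = true`, and
-- `false xor l` is `l`.
∃ᵛ (equality false) = varying false
∃ᵛ v                = v

value : Term → Value
value e       = equality true
value (rel R) = varying false
value (p′ 𝒯)  = value 𝒯
value (s′ 𝒯)  = value 𝒯
value (I′ 𝒯)  = Iᵛ (value 𝒯)
value (¬′ 𝒯)  = ¬ᵛ (value 𝒯)
value (∃′ 𝒯)  = ∃ᵛ (value 𝒯)

-- Operators on full and empty relations

Uniform : {A : Set} {k : ℕ} → ADRel A k → Bool → Set
Uniform R b = ∀ t → Reflects (R t) b

-- `P` is the argument relation and `Q` the result at one tuple. The full case needs only one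
-- witness `x`, the empty case only the way back, so nothing has to be decided.
reflects-transfer : {X Q : Set} {P : X → Set} {b : Bool} →
                    (∀ x → Reflects (P x) b) →
                    (Q → ∃ P) → (x : X) → (P x → Q) → Reflects Q b
reflects-transfer {b = true}  P∼b to x from = ofʸ (from (invert (P∼b x)))
reflects-transfer {b = false} P∼b to x from =
  ofⁿ λ q → let x , px = to q in invert (P∼b x) px

module _ {A : Set} {b : Bool} where

  p-uniform : ∀ {k} {R : ADRel A k} → Uniform R b → Uniform (pRel R) b
  p-uniform {zero}        u t       = u t
  p-uniform {suc zero}    u t       = u t
  p-uniform {suc (suc k)} u (a ∷ v) =
    reflects-transfer u (λ (v , a , r , _) → v ∷ʳ a , r) (v ∷ʳ a) λ r → v , a , r , refl

  s-uniform : ∀ {k} {R : ADRel A k} → Uniform R b → Uniform (sRel R) b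
  s-uniform {zero}        u t = u t
  s-uniform {suc zero}    u t = u t
  s-uniform {suc (suc k)} u t with w , a , refl ← initLast t with v , b , refl ← initLast w =
    reflects-transfer u (λ (v , a , b , r , _) → (v ∷ʳ a) ∷ʳ b , r) ((v ∷ʳ a) ∷ʳ b)
      λ r → v , a , b , r , refl

  I-uniform : ∀ {k} {R : ADRel A k} → Uniform R b → Uniform (IRel R) b
  I-uniform {zero}        u t = u t
  I-uniform {suc zero}    u t = u t
  I-uniform {suc (suc k)} u t =
    reflects-transfer u (λ (a , r , _) → t ∷ʳ a , r) (t ∷ʳ last t) λ r → last t , r , refl

  -- Over an empty domain a full unary relation would have an empty projection; hence the given
  -- element.
  ∃-uniform : ∀ {k} {R : ADRel A k} → A → Uniform R b → Uniform (∃Rel R) b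
  ∃-uniform {zero}  a u t = u t
  ∃-uniform {suc k} a u t = reflects-transfer (λ x → u (t ∷ʳ x)) id a (a ,_)

-- Values describe denotations

-- Several elements and full symbols for l = true, one element and empty
-- symbols for l = false.

record Extremal {τ : Vocabulary} (𝔄 : Model τ) (l : Bool) : Set where
  field
    symbols : ∀ R .(m : R ∈ τ) → Uniform (interp 𝔄 R m) l
    others  : (x : Domain 𝔄) → Reflects (∃[ y ] x ≢ y) l

-- Equality on the domain need not be decidable, so an equality value only
-- records what is known about equal and about distinct arguments.

data Denotes {τ : Vocabulary} (𝔄 : Model τ) : ∀ {k} → ADRel (Domain 𝔄) k → Value → Set₁ where
  equality : ∀ {R : ADRel (Domain 𝔄) 2} {b} →
             (∀ {x y} → x ≡ y → Reflects (R (x ∷ y ∷ [])) b) →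
             (∀ {x y} → x ≢ y → Reflects (R (x ∷ y ∷ [])) (not b)) →
             Denotes 𝔄 R (equality b)
  uniform  : ∀ {k} {R : ADRel (Domain 𝔄) k} {b} → Uniform R b → Denotes 𝔄 R (uniform b)
  varying  : ∀ {k} {R : ADRel (Domain 𝔄) k} {b} →
             (∀ {l} → Extremal 𝔄 l → Uniform R (b xor l)) → Denotes 𝔄 R (varying b)

module _ {τ : Vocabulary} {𝔄 : Model τ} where

  eqRel-denotes : Denotes 𝔄 eqRel (equality true)
  eqRel-denotes = equality (λ { refl → ofʸ (_ , refl) }) λ x≢y → ofⁿ λ { (_ , refl) → x≢y refl }

  pRel-denotes : ∀ {k} {R : ADRel (Domain 𝔄) k} {v} → Denotes 𝔄 R v → Denotes 𝔄 (pRel R) v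
  -- On pairs the operator exchanges the arguments, and = and ≠ are symmetric.
  pRel-denotes {R = R} (equality same diff) = equality (swap ∘ same ∘ sym) (swap ∘ diff ∘ ≢-sym)
    where
    swap : ∀ {x y b} → Reflects (R (y ∷ x ∷ [])) b → Reflects (pRel R (x ∷ y ∷ [])) b
    swap r = reflects-transfer {X = ⊤} (λ _ → r) (λ { (_ , _ , r , refl) → tt , r }) tt
               λ r → _ , _ , r , refl
  pRel-denotes (uniform u) = uniform (p-uniform u)
  pRel-denotes (varying u) = varying (p-uniform ∘ u)

  sRel-denotes : ∀ {k} {R : ADRel (Domain 𝔄) k} {v} → Denotes 𝔄 R v → Denotes 𝔄 (sRel R) v
  sRel-denotes {R = R} (equality same diff) = equality (swap ∘ same ∘ sym) (swap ∘ diff ∘ ≢-sym)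
    where
    swap : ∀ {x y b} → Reflects (R (y ∷ x ∷ [])) b → Reflects (sRel R (x ∷ y ∷ [])) b
    swap r = reflects-transfer {X = ⊤} (λ _ → r) (λ { ([] , _ , _ , r , refl) → tt , r }) tt
               λ r → [] , _ , _ , r , refl
  sRel-denotes (uniform u) = uniform (s-uniform u)
  sRel-denotes (varying u) = varying (s-uniform ∘ u)

  IRel-denotes : ∀ {k} {R : ADRel (Domain 𝔄) k} {v} → Denotes 𝔄 R v → Denotes 𝔄 (IRel R) (Iᵛ v)
  -- Only the diagonal is inspected, so `same` suffices.
  IRel-denotes (equality same diff) = uniform λ where
    (x ∷ []) → reflects-transfer {X = ⊤} (λ _ → same refl) (λ { (_ , r , refl) → tt , r }) tt
                 λ r → x , r , refl
  IRel-denotes (uniform u) = uniform (I-uniform u)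
  IRel-denotes (varying u) = varying (I-uniform ∘ u)

  ¬Rel-denotes : ∀ {k} {R : ADRel (Domain 𝔄) k} {v} → Denotes 𝔄 R v → Denotes 𝔄 (¬Rel R) (¬ᵛ v)
  ¬Rel-denotes (equality same diff) = equality (¬-reflects ∘ same) (¬-reflects ∘ diff)
  ¬Rel-denotes (uniform u) = uniform (¬-reflects ∘ u)
  ¬Rel-denotes (varying {b = b} u) = varying λ {l} 𝔄-l t →
    subst (Reflects _) (not-distribˡ-xor b l) (¬-reflects (u 𝔄-l t))

  ∃Rel-denotes : ∀ {k} {R : ADRel (Domain 𝔄) k} {v} → Denotes 𝔄 R v → Denotes 𝔄 (∃Rel R) (∃ᵛ v)
  ∃Rel-denotes (equality {b = true}  same diff) = uniform λ where
    (x ∷ []) → ofʸ (x , invert (same refl))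
  ∃Rel-denotes (equality {R} {false} same diff) =
    varying λ { 𝔄-l (x ∷ []) → exists (Extremal.others 𝔄-l x) }
    where
    exists : ∀ {x l} → Reflects (∃[ y ] x ≢ y) l → Reflects (∃[ y ] R (x ∷ y ∷ [])) l
    exists (ofʸ (y , x≢y)) = ofʸ (y , invert (diff x≢y))
    -- A related `y` cannot equal `x`, so it would be a second element; equality is never decided.
    exists (ofⁿ none)      = ofⁿ λ (y , r) → none (y , λ x≡y → invert (same x≡y) r)
  ∃Rel-denotes (uniform u) = uniform (∃-uniform (nonempty 𝔄) u)
  ∃Rel-denotes (varying u) = varying (∃-uniform (nonempty 𝔄) ∘ u)

denotes-value : ∀ 𝒯 {τ} (𝔄 : Model τ) .(m : SymbolsIn τ 𝒯) → Denotes 𝔄 (⟦ 𝒯 ⟧ 𝔄 m) (value 𝒯)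
denotes-value e       𝔄 m = eqRel-denotes
denotes-value (rel R) 𝔄 m = varying λ 𝔄-l → Extremal.symbols 𝔄-l R m
denotes-value (p′ 𝒯)  𝔄 m = pRel-denotes (denotes-value 𝒯 𝔄 m)
denotes-value (s′ 𝒯)  𝔄 m = sRel-denotes (denotes-value 𝒯 𝔄 m)
denotes-value (I′ 𝒯)  𝔄 m = IRel-denotes (denotes-value 𝒯 𝔄 m)
denotes-value (¬′ 𝒯)  𝔄 m = ¬Rel-denotes (denotes-value 𝒯 𝔄 m)
denotes-value (∃′ 𝒯)  𝔄 m = ∃Rel-denotes (denotes-value 𝒯 𝔄 m)

-- Satisfiability read off the value

satᵛ : Value → Bool
satᵛ (uniform b) = b
satᵛ _           = true

-- Interpreting all symbols at once lets the same two models serve every term.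
extremalModel : Bool → Model U
extremalModel l .Domain       = if l then Bool else ⊤
extremalModel true  .nonempty = true
extremalModel false .nonempty = tt
extremalModel l .interp R _ _ = T l

extremalModel-extremal : ∀ l → Extremal (extremalModel l) l
extremalModel-extremal true  = record
  { symbols = λ _ _ _ → ofʸ tt
  ; others  = λ { true → ofʸ (false , λ ()) ; false → ofʸ (true , λ ()) } }
extremalModel-extremal false = record
  { symbols = λ _ _ _ → ofⁿ id
  ; others  = λ _ → ofⁿ λ (_ , x≢y) → x≢y refl }

-- The value alone determines `l`, which is fixed before `R` because the type of `R` mentions it.
-- For `varying b`, `l` is chosen with `b xor l` true.
denotes⇒inhabited : ∀ {v} → T (satᵛ v) →
                    Σ[ l ∈ Bool ] (∀ {k} {R : ADRel (Domain (extremalModel l)) k} →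
                                   Denotes (extremalModel l) R v → ∃ R)
denotes⇒inhabited {equality true}  _ = true , λ where
  (equality same diff) → true ∷ true ∷ [] , invert (same refl)
denotes⇒inhabited {equality false} _ = true , λ where
  (equality same diff) → true ∷ false ∷ [] , invert (diff λ ())
denotes⇒inhabited {uniform true}   _ = true , λ where
  (uniform u) → Vec.replicate _ true , invert (u _)
denotes⇒inhabited {varying true}   _ = false , λ where
  (varying u) → Vec.replicate _ tt , invert (u (extremalModel-extremal false) _)
denotes⇒inhabited {varying false}  _ = true , λ where
  (varying u) → Vec.replicate _ true , invert (u (extremalModel-extremal true) _)

symbolsIn-U : ∀ 𝒯 → SymbolsIn U 𝒯
symbolsIn-U e       = tt
symbolsIn-U (rel R) = tt
symbolsIn-U (p′ 𝒯)  = symbolsIn-U 𝒯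
symbolsIn-U (s′ 𝒯)  = symbolsIn-U 𝒯
symbolsIn-U (I′ 𝒯)  = symbolsIn-U 𝒯
symbolsIn-U (¬′ 𝒯)  = symbolsIn-U 𝒯
symbolsIn-U (∃′ 𝒯)  = symbolsIn-U 𝒯

satᵛ⇒satisfiable : ∀ 𝒯 → T (satᵛ (value 𝒯)) → SatisfiableTerm 𝒯
satᵛ⇒satisfiable 𝒯 ok =
  let l , inhabited = denotes⇒inhabited {value 𝒯} ok
      m             = symbolsIn-U 𝒯
      _ , t∈        = inhabited (denotes-value 𝒯 (extremalModel l) m)
  in  U , m , extremalModel l , λ (⊆∅ , _) → ⊆∅ t∈

satisfiable⇒satᵛ : ∀ 𝒯 → SatisfiableTerm 𝒯 → T (satᵛ (value 𝒯))
satisfiable⇒satᵛ 𝒯 (τ , m , 𝔄 , nonempty) with value 𝒯 | denotes-value 𝒯 𝔄 m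
... | equality _    | _         = tt
... | uniform true  | _         = tt
... | uniform false | uniform u = nonempty ((λ {t} → invert (u t)) , λ ())
... | varying _     | _         = tt

-- The automaton

-- reading (t , u , w) says that the operators read so far make a term
-- satisfiable when applied to a full relation iff t, to an empty one iff not t,
-- to = iff u, and to ≠ iff w.

data Suffix : Set where
  end sups subs dead : Suffix

State : Set
State = (Bool × Bool × Bool) ⊎ Suffix

pattern reading q = inj₁ q
pattern after x   = inj₂ x

start : State
start = reading (true , true , true)

-- The next operator acts before those already read, so each new bit is the old verdict on its
-- image: I sends = to full and ≠ to empty, while ∃ sends ≠ to a varying relation, which is always
-- accepted.
step : State → Letter → State
step (reading q)           `p   = reading q
step (reading q)           `s   = reading q
step (reading (t , u , w)) `I   = reading (t , t , not t)
step (reading (t , u , w)) `¬   = reading (not t , w , u)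
step (reading (t , u , w)) `∃   = reading (t , t , true)
step (reading (t , u , w)) `e   = after (if u then end else dead)
-- Terms over a symbol are always satisfiable, so the triple is dropped and only the spelling is
-- checked.
step (reading q)           `R   = after sups
step (reading q)           `sup = after dead
step (reading q)           `sub = after dead
step (after sups)          `sup = after sups
step (after sups)          `sub = after subs
step (after subs)          `sub = after subs
step (after _)             _    = after dead

final : State → Bool
final (reading _)  = false
final (after dead) = false
final (after _)    = true

-- Runs on spelled terms

Accepts : State → List Letter → Set
Accepts q w = T (final (foldl step q w))

acceptᵛ : Bool × Bool × Bool → Value → Bool
acceptᵛ (t , u , w) (equality b) = if b then u else w
acceptᵛ (t , u , w) (uniform b)  = if b then t else not t
acceptᵛ (t , u , w) (varying b)  = true

run-replicate-sub : ∀ i → final (foldl step (after subs) (replicate i `sub)) ≡ true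
run-replicate-sub zero    = refl
run-replicate-sub (suc i) = run-replicate-sub i

run-spellSym : ∀ k i → final (foldl step (after sups) (replicate k `sup ++ replicate i `sub)) ≡ true
run-spellSym zero    zero    = refl
run-spellSym zero    (suc i) = run-replicate-sub i
run-spellSym (suc k) i       = run-spellSym k i

-- Induction on the term with `q` arbitrary: reading an operator changes `q` exactly as applying it
-- changes the value.
run-spell : ∀ 𝒯 q → final (foldl step (reading q) (spell 𝒯)) ≡ acceptᵛ q (value 𝒯)
run-spell e       (t , true  , w) = refl
run-spell e       (t , false , w) = refl
run-spell (rel R) q = run-spellSym (arity R) (index R)
run-spell (p′ 𝒯)  q = run-spell 𝒯 q
run-spell (s′ 𝒯)  q = run-spell 𝒯 q
run-spell (I′ 𝒯)  q@(t , u , w) = trans (run-spell 𝒯 (t , t , not t)) (acceptᵛ-I (value 𝒯))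
  where
  acceptᵛ-I : ∀ v → acceptᵛ (t , t , not t) v ≡ acceptᵛ q (Iᵛ v)
  acceptᵛ-I (equality _) = refl
  acceptᵛ-I (uniform _)  = refl
  acceptᵛ-I (varying _)  = refl
run-spell (¬′ 𝒯)  q@(t , u , w) = trans (run-spell 𝒯 (not t , w , u)) (acceptᵛ-¬ (value 𝒯))
  where
  acceptᵛ-¬ : ∀ v → acceptᵛ (not t , w , u) v ≡ acceptᵛ q (¬ᵛ v)
  acceptᵛ-¬ (equality true)  = refl
  acceptᵛ-¬ (equality false) = refl
  acceptᵛ-¬ (uniform true)   = refl
  acceptᵛ-¬ (uniform false)  = not-involutive t
  acceptᵛ-¬ (varying _)      = refl
run-spell (∃′ 𝒯)  q@(t , u , w) = trans (run-spell 𝒯 (t , t , true)) (acceptᵛ-∃ (value 𝒯))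
  where
  acceptᵛ-∃ : ∀ v → acceptᵛ (t , t , true) v ≡ acceptᵛ q (∃ᵛ v)
  acceptᵛ-∃ (equality true)  = refl
  acceptᵛ-∃ (equality false) = refl
  acceptᵛ-∃ (uniform _)      = refl
  acceptᵛ-∃ (varying _)      = refl

run-start-spell : ∀ 𝒯 → final (foldl step start (spell 𝒯)) ≡ satᵛ (value 𝒯)
run-start-spell 𝒯 = trans (run-spell 𝒯 (true , true , true)) (acceptᵛ-start (value 𝒯))
  where
  acceptᵛ-start : ∀ v → acceptᵛ (true , true , true) v ≡ satᵛ v
  acceptᵛ-start (equality true)  = refl
  acceptᵛ-start (equality false) = refl
  acceptᵛ-start (uniform true)   = refl
  acceptᵛ-start (uniform false)  = refl
  acceptᵛ-start (varying _)      = refl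

-- Accepted words are spellings

dead-rejects : ∀ w → ¬ Accepts (after dead) w
dead-rejects (_ ∷ w) = dead-rejects w

end-accepts : ∀ w → Accepts (after end) w → w ≡ []
end-accepts []      _   = refl
end-accepts (_ ∷ w) acc = contradiction acc (dead-rejects w)

subs-accepts : ∀ w → Accepts (after subs) w → ∃[ i ] replicate i `sub ≡ w
subs-accepts []         _   = 0 , refl
subs-accepts (`sub ∷ w) acc = let i , eq = subs-accepts w acc in suc i , cong (`sub ∷_) eq
subs-accepts (`e ∷ w)   acc = contradiction acc (dead-rejects w)
subs-accepts (`p ∷ w)   acc = contradiction acc (dead-rejects w)
subs-accepts (`s ∷ w)   acc = contradiction acc (dead-rejects w)
subs-accepts (`I ∷ w)   acc = contradiction acc (dead-rejects w)
subs-accepts (`¬ ∷ w)   acc = contradiction acc (dead-rejects w)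
subs-accepts (`∃ ∷ w)   acc = contradiction acc (dead-rejects w)
subs-accepts (`R ∷ w)   acc = contradiction acc (dead-rejects w)
subs-accepts (`sup ∷ w) acc = contradiction acc (dead-rejects w)

sups-accepts : ∀ w → Accepts (after sups) w →
               ∃[ k ] ∃[ i ] replicate k `sup ++ replicate i `sub ≡ w
sups-accepts []         _   = 0 , 0 , refl
sups-accepts (`sup ∷ w) acc = let k , i , eq = sups-accepts w acc in suc k , i , cong (`sup ∷_) eq
sups-accepts (`sub ∷ w) acc = let i , eq = subs-accepts w acc in 0 , suc i , cong (`sub ∷_) eq
sups-accepts (`e ∷ w)   acc = contradiction acc (dead-rejects w)
sups-accepts (`p ∷ w)   acc = contradiction acc (dead-rejects w)
sups-accepts (`s ∷ w)   acc = contradiction acc (dead-rejects w)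
sups-accepts (`I ∷ w)   acc = contradiction acc (dead-rejects w)
sups-accepts (`¬ ∷ w)   acc = contradiction acc (dead-rejects w)
sups-accepts (`∃ ∷ w)   acc = contradiction acc (dead-rejects w)
sups-accepts (`R ∷ w)   acc = contradiction acc (dead-rejects w)

-- The letters dictate the term. The empty word is excluded because no reading state is final.
reading-accepts : ∀ q w → Accepts (reading q) w → ∃[ 𝒯 ] spell 𝒯 ≡ w
reading-accepts q (`p ∷ w)   acc = let 𝒯 , eq = reading-accepts _ w acc in p′ 𝒯 , cong (`p ∷_) eq
reading-accepts q (`s ∷ w)   acc = let 𝒯 , eq = reading-accepts _ w acc in s′ 𝒯 , cong (`s ∷_) eq
reading-accepts q (`I ∷ w)   acc = let 𝒯 , eq = reading-accepts _ w acc in I′ 𝒯 , cong (`I ∷_) eq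
reading-accepts q (`¬ ∷ w)   acc = let 𝒯 , eq = reading-accepts _ w acc in ¬′ 𝒯 , cong (`¬ ∷_) eq
reading-accepts q (`∃ ∷ w)   acc = let 𝒯 , eq = reading-accepts _ w acc in ∃′ 𝒯 , cong (`∃ ∷_) eq
reading-accepts q (`R ∷ w)   acc =
  let k , i , eq = sups-accepts w acc in rel (relSym k i) , cong (`R ∷_) eq
reading-accepts (t , true  , _) (`e ∷ w) acc = e , cong (`e ∷_) (sym (end-accepts w acc))
reading-accepts (t , false , _) (`e ∷ w) acc = contradiction acc (dead-rejects w)
reading-accepts q (`sup ∷ w) acc = contradiction acc (dead-rejects w)
reading-accepts q (`sub ∷ w) acc = contradiction acc (dead-rejects w)

-- Finiteness and conclusion

finite-Bool : Finite Bool
finite-Bool = 2 , ↔-sym 2↔Bool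

finite-× : {A B : Set} → Finite A → Finite B → Finite (A × B)
finite-× (m , A↔m) (n , B↔n) = m * n , ↔-trans (A↔m ×-↔ B↔n) (↔-sym *↔×)

finite-⊎ : {A B : Set} → Finite A → Finite B → Finite (A ⊎ B)
finite-⊎ (m , A↔m) (n , B↔n) = m + n , ↔-trans (A↔m ⊎-↔ B↔n) (↔-sym +↔⊎)

-- The inverse law over `Fin n` is settled by computation; the one over `A` is supplied by cases.
finite-enumerated : ∀ {A : Set} {n} (xs : Vec A n) (position : A → Fin n) →
                    {_ : True (all? λ i → position (lookup xs i) ≟ i)} →
                    (∀ x → lookup xs (position x) ≡ x) → Finite A
finite-enumerated xs position {distinct} complete =
  _ , mk↔ₛ′ position (lookup xs) (toWitness distinct) complete

finite-Suffix : Finite Suffix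
finite-Suffix = finite-enumerated (end ∷ sups ∷ subs ∷ dead ∷ [])
  (λ { end → 0F ; sups → 1F ; subs → 2F ; dead → 3F })
  (λ { end → refl ; sups → refl ; subs → refl ; dead → refl })

finite-Letter : Finite Letter
finite-Letter = finite-enumerated (`e ∷ `p ∷ `s ∷ `I ∷ `¬ ∷ `∃ ∷ `R ∷ `sup ∷ `sub ∷ [])
  (λ { `e → 0F ; `p → 1F ; `s → 2F ; `I → 3F ; `¬ → 4F ; `∃ → 5F ; `R → 6F ; `sup → 7F ; `sub → 8F })
  (λ { `e → refl ; `p → refl ; `s → refl ; `I → refl ; `¬ → refl ; `∃ → refl ; `R → refl
     ; `sup → refl ; `sub → refl })

automaton : DFA Letter
automaton = record
  { finiteAlphabet = finite-Letter
  ; State          = State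
  ; finiteState    = finite-⊎ (finite-× finite-Bool (finite-× finite-Bool finite-Bool)) finite-Suffix
  ; start          = start
  ; step           = step
  ; final          = final
  }

theorem5p5 : REG SatisfiableTerms
theorem5p5 = automaton , satisfiable⇒accepted , accepted⇒satisfiable
  where
  satisfiable⇒accepted : SatisfiableTerms ⊆ accepted automaton
  satisfiable⇒accepted (𝒯 , refl , sat) =
    subst T (sym (run-start-spell 𝒯)) (satisfiable⇒satᵛ 𝒯 sat)

  accepted⇒satisfiable : accepted automaton ⊆ SatisfiableTerms
  -- Parsing comes first: the run determines a value only once the word is known to spell a term.
  accepted⇒satisfiable {w} acc with 𝒯 , refl ← reading-accepts (true , true , true) w acc =
    𝒯 , refl , satᵛ⇒satisfiable 𝒯 (subst T (run-start-spell 𝒯) acc)
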